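{- The $\Sigma_1$-covering problem is decidable.
   Context: $A$ is a fixed finite alphabet; languages are subsets of $A^*$. **The class $\Sigma_1$.** A word is viewed as a (possibly empty) linearly ordered sequence of positions labeled over $A$; first-order sentences use unary predicates $P_a$ ($a\in A$) and the strict order $<$. A $\Sigma_1$ sentence is one whose prenex normal form has only existential quantifiers (a single block of existential quantifiers, or no quantifier). $\Sigma_1$ also denotes the class of languages over $A$ definable by such sentences. **Covering.** For a class $\mathcal{C}$ and a language $L$, a $\mathcal{C}$-cover of $L$ is a finite set $\mathbf{K}$ of languages belonging to $\mathcal{C}$ with $L\subseteq\bigcup_{K\in\mathbf{K}}K$. A set $\mathbf{K}$ of languages is separating for a finite multiset of languages $\mathbf{L}$ if for every $K\in\mathbf{K}$ there exists $L'\in\mathbf{L}$ with $K\cap L'=\emptyset$. The pair $(L,\mathbf{L})$ is $\mathcal{C}$-coverable if there is a $\mathcal{C}$-cover of $L$ that is separating for $\mathbf{L}$. The $\mathcal{C}$-covering problem: given as input a regular language $L$ and a finite multiset $\mathbf{L}$ of regular languages (given by nondeterministic finite automata or by morphisms into finite monoids), decide whether $(L,\mathbf{L})$ is $\mathcal{C}$-coverable. -}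

module Defs where

open import Algebra.Bundles.Raw using (RawMonoid)
open import Algebra.Core using (Op₂)
open import Algebra.Morphism.Structures using (IsMonoidHomomorphism)
open import Algebra.Structures using (IsMonoid)
open import Data.Fin.Base as Fin using (Fin)
open import Data.Fin.Subset as Subset using (Subset)
open import Data.List.Base using (List; []; _∷_; length; lookup; ++-[]-rawMonoid)
open import Data.List.Relation.Unary.All using (All)
open import Data.List.Relation.Unary.Any using (Any)
open import Data.Nat.Base using (ℕ; suc)
open import Data.Product.Base using (_×_; ∃-syntax)
open import Data.Sum.Base using (_⊎_)
open import Data.Unit.Base using (⊤)
open import Data.Vec.Base as Vec using (Vec; []; _∷_)
open import Level using (Level; 0ℓ; _⊔_)
open import Relation.Binary.PropositionalEquality.Core using (_≡_)
open import Relation.Nullary.Negation.Core using (¬_)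
open import Relation.Unary using (Pred; _∈_; _∩_; _⊆_; _≐_; Empty)

private variable
  c : Level
  A : Set
  n : ℕ

Language : Set → Set₁
Language A = Pred (List A) 0ℓ

------------------------------------------------------------------------
-- First-order logic over words

-- `Formula A n` has its free variables among n de Bruijn indices.
-- Equality is not a primitive: on a linear order, x = y is the
-- quantifier-free formula ¬ (x < y) ∧ ¬ (y < x). The constant `true` is,
-- because otherwise there would be no quantifier-free sentence.
data Formula (A : Set) (n : ℕ) : Set where
  true      : Formula A n
  P[_]_     : A → Fin n → Formula A n
  _<′_      : Fin n → Fin n → Formula A n
  ¬′_       : Formula A n → Formula A n
  _∧′_ _∨′_ : Formula A n → Formula A n → Formula A n
  ∃′_ ∀′_   : Formula A (suc n) → Formula A n

Sentence : Set → Set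
Sentence A = Formula A 0

Position : List A → Set
Position w = Fin (length w)

_,_⊨_ : (w : List A) → Vec (Position w) n → Formula A n → Set
w , ρ ⊨ true      = ⊤
w , ρ ⊨ (P[ a ] x) = lookup w (Vec.lookup ρ x) ≡ a
w , ρ ⊨ (x <′ y)  = Vec.lookup ρ x Fin.< Vec.lookup ρ y
w , ρ ⊨ (¬′ φ)    = ¬ (w , ρ ⊨ φ)
w , ρ ⊨ (φ ∧′ ψ)  = (w , ρ ⊨ φ) × (w , ρ ⊨ ψ)
w , ρ ⊨ (φ ∨′ ψ)  = (w , ρ ⊨ φ) ⊎ (w , ρ ⊨ ψ)
w , ρ ⊨ (∃′ φ)    = ∃[ i ] (w , i ∷ ρ ⊨ φ)
w , ρ ⊨ (∀′ φ)    = ∀ i → w , i ∷ ρ ⊨ φ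

models : Sentence A → Language A
models φ w = w , [] ⊨ φ

data QuantifierFree {A : Set} {n : ℕ} : Formula A n → Set where
  true  : QuantifierFree true
  P[_]_ : ∀ a x → QuantifierFree (P[ a ] x)
  _<′_  : ∀ x y → QuantifierFree (x <′ y)
  ¬′_   : ∀ {φ} → QuantifierFree φ → QuantifierFree (¬′ φ)
  _∧′_  : ∀ {φ ψ} → QuantifierFree φ → QuantifierFree ψ → QuantifierFree (φ ∧′ ψ)
  _∨′_  : ∀ {φ ψ} → QuantifierFree φ → QuantifierFree ψ → QuantifierFree (φ ∨′ ψ)

-- Prenex formulas whose prefix is a possibly empty block of ∃.
data ∃Prenex {A : Set} : {n : ℕ} → Formula A n → Set where
  matrix : {φ : Formula A n} → QuantifierFree φ → ∃Prenex φ
  ∃′_    : {φ : Formula A (suc n)} → ∃Prenex φ → ∃Prenex (∃′ φ)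

-- Prenex normal forms are unique only up to equivalence: φ is a Σ₁
-- sentence when some equivalent prenex sentence has only existential
-- quantifiers.
IsΣ₁Sentence : Sentence A → Set
IsΣ₁Sentence {A} φ = ∃[ ψ ] (∃Prenex {A} {0} ψ × models φ ≐ models ψ)

Σ₁ : Pred (Language A) 0ℓ
Σ₁ {A} L = ∃[ φ ] (IsΣ₁Sentence {A} φ × L ≐ models φ)

------------------------------------------------------------------------
-- Covering

-- Finite sets and finite multisets of languages are given by lists; no
-- notion below depends on the order or the repetitions of the entries.

⋃ : List (Language A) → Pred (List A) (Level.suc 0ℓ)
⋃ 𝐊 w = Any (λ K → w ∈ K) 𝐊

IsCover : Pred (Language A) c → Language A → List (Language A) → Set (c ⊔ Level.suc 0ℓ)
IsCover 𝒞 L 𝐊 = All (_∈ 𝒞) 𝐊 × L ⊆ ⋃ 𝐊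

IsSeparatingFor : List (Language A) → List (Language A) → Set₁
IsSeparatingFor 𝐊 𝐋 = All (λ K → Any (λ L′ → Empty (K ∩ L′)) 𝐋) 𝐊

Coverable : Pred (Language A) c → Language A → List (Language A) → Set (c ⊔ Level.suc 0ℓ)
Coverable 𝒞 L 𝐋 = ∃[ 𝐊 ] (IsCover 𝒞 L 𝐊 × IsSeparatingFor 𝐊 𝐋)

------------------------------------------------------------------------
-- Presentations of regular languages

record NFA (A : Set) : Set where
  field
    states  : ℕ
    initial : Subset states
    final   : Subset states
    δ       : Fin states → A → Subset states

  data Run : Fin states → List A → Fin states → Set where
    []  : ∀ {q} → Run q [] q
    _∷_ : ∀ {q r s a w} → r Subset.∈ δ q a → Run r w s → Run q (a ∷ w) s

  Accepts : Language A
  Accepts w = ∃[ q ] ∃[ r ] (q Subset.∈ initial × Run q w r × r Subset.∈ final)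

-- A morphism α from A* into a finite monoid, with the accepting set F
-- such that the language is α⁻¹(F). The elements of the monoid are
-- numbered, so that it is given by its multiplication table.
record MonoidRecognizer (A : Set) : Set where
  field
    size     : ℕ
    _∙_      : Op₂ (Fin size)
    ε        : Fin size
    isMonoid : IsMonoid _≡_ _∙_ ε

  rawMonoid : RawMonoid 0ℓ 0ℓ
  rawMonoid = record { _≈_ = _≡_ ; _∙_ = _∙_ ; ε = ε }

  field
    α              : List A → Fin size
    isHomomorphism : IsMonoidHomomorphism (++-[]-rawMonoid A) rawMonoid α
    F              : Subset size

  Recognizes : Language A
  Recognizes w = α w Subset.∈ F

data RegularPresentation (A : Set) : Set where
  nfa      : NFA A → RegularPresentation A
  morphism : MonoidRecognizer A → RegularPresentation A

⟦_⟧ : RegularPresentation A → Language A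
⟦ nfa 𝒜 ⟧      = NFA.Accepts 𝒜
⟦ morphism ℳ ⟧ = MonoidRecognizer.Recognizes ℳ

{-# OPTIONS --safe #-}

-- A Σ₁ language is closed under superwords, so some L′ in 𝐋 misses a member K
-- of a separating cover, and then no word of K is a subword of a word of L′.
-- Hence (L , 𝐋) is coverable only if L ∩ ⋂ ↓L′ is empty, where ↓L′ is the set
-- of subwords of words of L′. Conversely, the complement of ⋂ ↓L′ is closed
-- under superwords and regular; by pumping, each of its words contains one of
-- its words of length at most N, for N the index of a right congruence. The
-- sets of superwords of those finitely many short words are Σ₁ and form the
-- required cover. Emptiness of the regular language L ∩ ⋂ ↓L′ is decidable.

module Submission where

open import Defs
open import Algebra.Morphism.Structures using (IsMonoidHomomorphism)
open import Data.Bool.Base using (if_then_else_)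
open import Data.Fin.Base as Fin using (Fin; zero; suc; toℕ; combine; funToFin; finToFun)
import Data.Fin.Properties as Fin
import Data.Fin.Subset as Subset
open import Data.Fin.Subset.Properties using (_∈?_)
open import Data.List.Base
  using (List; []; _∷_; [_]; _++_; map; length; lookup; take; drop; filter; allFin; cartesianProductWith)
open import Data.List.Membership.Propositional using (lose) renaming (_∈_ to _∈ˡ_)
open import Data.List.Membership.Propositional.Properties
  using (∈-cartesianProductWith⁺; ∈-allFin; ∈-map⁺; ∈-filter⁺)
open import Data.List.Properties using (++-assoc; take++drop≡id)
open import Data.List.Relation.Binary.Sublist.Propositional
  using ([]; _∷_; _∷ʳ_; minimum; ⊆-refl; ⊆-trans) renaming (_⊆_ to _⊑_)
open import Data.List.Relation.Binary.Sublist.Propositional.Properties using (++⁺; ++⁺ˡ)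
open import Data.List.Relation.Unary.All as All using (All; []; _∷_)
import Data.List.Relation.Unary.All.Properties as All
open import Data.List.Relation.Unary.Any as Any using (Any; any?)
import Data.List.Relation.Unary.Any.Properties as Any
open import Data.Nat.Base using (ℕ; zero; suc; _≤_; _<_; z≤n; s≤s; z<s; s<s; s<s⁻¹; _^_; _*_)
open import Data.Nat.Induction using (<-wellFounded)
import Data.Nat.Properties as ℕ
open import Data.Product.Base using (∃-syntax; _×_; _,_; proj₁; proj₂; map₂)
import Data.Sum.Base as Sum
open import Data.Vec.Base as Vec using (Vec; []; _∷_)
import Data.Vec.Properties as Vec
open import Function.Base using (_∘_; _|>_; id)
open import Function.Bundles using (_↔_; Inverse; _⇔_; mk⇔; Equivalence)
open import Induction.WellFounded using (Acc; acc)
open import Level using (0ℓ)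
open import Relation.Binary.Definitions using (tri<; tri≈; tri>)
open import Relation.Binary.PropositionalEquality
  using (_≡_; _≗_; refl; sym; trans; cong; cong₂; subst; subst₂)
open import Relation.Nullary.Decidable.Core using (Dec; yes; no; does; map′; _×-dec_; ¬?)
open import Relation.Nullary.Negation.Core using (¬_; contradiction)
open import Relation.Unary using (Pred; Decidable; _∩_; ∁; _∈_; _⊆_)

open Equivalence using (to; from)

private variable
  A : Set
  m n : ℕ
  L M : Language A
  w u : List A

↓ : Language A → Language A
↓ L w = ∃[ u ] (w ⊑ u × u ∈ L)

↑ : List A → Language A
↑ w u = w ⊑ u

-- Subwords as embeddings of positions

-- Variables take positions as values, so a map of positions can be composed with an assignment,
-- which suits the semantics better than a derivation of `w ⊑ u`.
record Embedding {A : Set} (w u : List A) : Set where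
  field
    pos       : Position w → Position u
    pos-mono  : ∀ {i j} → i Fin.< j → pos i Fin.< pos j
    pos-label : ∀ i → lookup u (pos i) ≡ lookup w i

  -- Trichotomy excludes the other two cases. This is what makes negated order atoms invariant too.
  pos-reflects : ∀ {i j} → pos i Fin.< pos j → i Fin.< j
  pos-reflects {i} {j} fi<fj with Fin.<-cmp i j
  ... | tri< i<j _ _  = i<j
  ... | tri≈ _ refl _ = contradiction fi<fj (ℕ.<-irrefl refl)
  ... | tri> _ _ j<i  = contradiction fi<fj (ℕ.<-asym (pos-mono j<i))

open Embedding

⊑⇒Embedding : w ⊑ u → Embedding w u
⊑⇒Embedding [] .pos ()
⊑⇒Embedding [] .pos-mono {()}
⊑⇒Embedding [] .pos-label ()
⊑⇒Embedding (y ∷ʳ s) .pos = suc ∘ ⊑⇒Embedding s .pos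
⊑⇒Embedding (y ∷ʳ s) .pos-mono = s<s ∘ ⊑⇒Embedding s .pos-mono
⊑⇒Embedding (y ∷ʳ s) .pos-label = ⊑⇒Embedding s .pos-label
⊑⇒Embedding (refl ∷ s) .pos zero = zero
⊑⇒Embedding (refl ∷ s) .pos (suc i) = suc (⊑⇒Embedding s .pos i)
⊑⇒Embedding (refl ∷ s) .pos-mono {zero} {suc j} _ = z<s
⊑⇒Embedding (refl ∷ s) .pos-mono {suc i} {suc j} i<j = s<s (⊑⇒Embedding s .pos-mono (s<s⁻¹ i<j))
⊑⇒Embedding (refl ∷ s) .pos-label zero = refl
⊑⇒Embedding (refl ∷ s) .pos-label (suc i) = ⊑⇒Embedding s .pos-label i

lower : (f : Fin m → Fin (suc n)) → (∀ i → zero {n} Fin.< f i) → ∀ i → ∃[ j ] f i ≡ suc j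
lower f 0<f i with f i | 0<f i
... | suc j | _ = j , refl

dropHead : ∀ {b : A} (e : Embedding w (b ∷ u)) → (∀ i → zero {length u} Fin.< e .pos i) → Embedding w u
dropHead e 0<e .pos i = proj₁ (lower (e .pos) 0<e i)
dropHead e 0<e .pos-mono {i} {j} i<j =
  s<s⁻¹ (subst₂ Fin._<_ (proj₂ (lower (e .pos) 0<e i)) (proj₂ (lower (e .pos) 0<e j)) (e .pos-mono i<j))
dropHead {u = u} {b} e 0<e .pos-label i =
  trans (cong (lookup (b ∷ u)) (sym (proj₂ (lower (e .pos) 0<e i)))) (e .pos-label i)

tailEmbedding : ∀ {a : A} → Embedding (a ∷ w) u → Embedding w u
tailEmbedding e .pos = e .pos ∘ suc
tailEmbedding e .pos-mono = e .pos-mono ∘ s<s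
tailEmbedding e .pos-label = e .pos-label ∘ suc

-- If the first position goes to position 0, the heads match and all later positions land strictly
-- beyond it. Otherwise monotonicity keeps every position away from 0, and the head of `u` is
-- skipped.
Embedding⇒⊑ : ∀ (w u : List A) → Embedding w u → w ⊑ u
Embedding⇒⊑ [] u e = minimum u
Embedding⇒⊑ (a ∷ w) [] e with () ← e .pos zero
Embedding⇒⊑ (a ∷ w) (b ∷ u) e with e .pos zero in eq
... | zero = trans (sym (e .pos-label zero)) (cong (lookup (b ∷ u)) eq)
    ∷ Embedding⇒⊑ w u (dropHead (tailEmbedding e) λ i →
        subst (Fin._< e .pos (suc i)) eq (e .pos-mono z<s))
... | suc j = b ∷ʳ Embedding⇒⊑ (a ∷ w) u (dropHead e 0<e)
  where
  0<e : ∀ i → zero {length u} Fin.< e .pos i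
  0<e zero    = subst (zero {length u} Fin.<_) (sym eq) z<s
  0<e (suc i) = ℕ.≤-<-trans z≤n (e .pos-mono {zero} {suc i} z<s)

-- Σ₁ and superwords

module _ {w u : List A} (e : Embedding w u) where

  -- An equivalence is proved because negation exchanges the two directions.
  quantifierFree-invariant : ∀ {φ : Formula A n} → QuantifierFree φ → (ρ : Vec (Position w) n) →
    (w , ρ ⊨ φ) ⇔ (u , Vec.map (e .pos) ρ ⊨ φ)
  quantifierFree-invariant true ρ = mk⇔ id id
  quantifierFree-invariant (P[ a ] x) ρ
    rewrite Vec.lookup-map x (e .pos) ρ | e .pos-label (Vec.lookup ρ x) = mk⇔ id id
  quantifierFree-invariant (x <′ y) ρ
    rewrite Vec.lookup-map x (e .pos) ρ | Vec.lookup-map y (e .pos) ρ =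
    mk⇔ (e .pos-mono) (pos-reflects e)
  quantifierFree-invariant (¬′ q) ρ =
    mk⇔ (_∘ from (quantifierFree-invariant q ρ)) (_∘ to (quantifierFree-invariant q ρ))
  quantifierFree-invariant (q ∧′ r) ρ =
    mk⇔ (λ (x , y) → to (quantifierFree-invariant q ρ) x , to (quantifierFree-invariant r ρ) y)
        (λ (x , y) → from (quantifierFree-invariant q ρ) x , from (quantifierFree-invariant r ρ) y)
  quantifierFree-invariant (q ∨′ r) ρ =
    mk⇔ (Sum.map (to (quantifierFree-invariant q ρ)) (to (quantifierFree-invariant r ρ)))
        (Sum.map (from (quantifierFree-invariant q ρ)) (from (quantifierFree-invariant r ρ)))

  -- The image of a witness is a witness. Only this direction survives quantification, as a witness
  -- in `u` may lie outside the image of `pos`.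
  ∃Prenex-preserved : ∀ {φ : Formula A n} → ∃Prenex φ → (ρ : Vec (Position w) n) →
    w , ρ ⊨ φ → u , Vec.map (e .pos) ρ ⊨ φ
  ∃Prenex-preserved (matrix q) ρ = to (quantifierFree-invariant q ρ)
  ∃Prenex-preserved (∃′ p) ρ (i , sat) = e .pos i , ∃Prenex-preserved p (i ∷ ρ) sat

Σ₁-upward-closed : L ∈ Σ₁ → w ⊑ u → w ∈ L → u ∈ L
Σ₁-upward-closed (φ , (ψ , ψ-prenex , φ⊆ψ , ψ⊆φ) , L⊆φ , φ⊆L) s w∈L =
  φ⊆L (ψ⊆φ (∃Prenex-preserved (⊑⇒Embedding s) ψ-prenex [] (φ⊆ψ (L⊆φ w∈L))))

⋀ : (Fin m → Formula A n) → Formula A n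
⋀ {zero}  φ = true
⋀ {suc m} φ = φ zero ∧′ ⋀ (φ ∘ suc)

⋀-quantifierFree : ∀ {φ : Fin m → Formula A n} → (∀ i → QuantifierFree (φ i)) → QuantifierFree (⋀ φ)
⋀-quantifierFree {zero}  q = true
⋀-quantifierFree {suc m} q = q zero ∧′ ⋀-quantifierFree (q ∘ suc)

⊨-⋀ : ∀ (φ : Fin m → Formula A n) {ρ : Vec (Position w) n} → (w , ρ ⊨ ⋀ φ) ⇔ (∀ i → w , ρ ⊨ φ i)
⊨-⋀ {zero}  φ = mk⇔ (λ _ ()) _
⊨-⋀ {suc m} φ = mk⇔
  (λ { (p , ps) zero → p ; (p , ps) (suc i) → to (⊨-⋀ (φ ∘ suc)) ps i })
  (λ p → p zero , from (⊨-⋀ (φ ∘ suc)) (p ∘ suc))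

∃* : Formula A n → Sentence A
∃* {n = zero}  φ = φ
∃* {n = suc n} φ = ∃* (∃′ φ)

∃*-prenex : {φ : Formula A n} → ∃Prenex φ → ∃Prenex (∃* φ)
∃*-prenex {n = zero}  p = p
∃*-prenex {n = suc n} p = ∃*-prenex (∃′ p)

⊨-∃* : (φ : Formula A n) → models (∃* φ) w ⇔ (∃[ ρ ] (w , ρ ⊨ φ))
⊨-∃* {n = zero}  φ = mk⇔ (_ ,_) λ { ([] , p) → p }
⊨-∃* {n = suc n} φ = mk⇔
  (λ p → let (ρ , i , q) = to (⊨-∃* (∃′ φ)) p in i ∷ ρ , q)
  (λ { (i ∷ ρ , q) → from (⊨-∃* (∃′ φ)) (ρ , i , q) })

-- The order of two indices of `w` is known while the formula is being built, so the premise is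
-- decided outside the logic.
_⇒′_ : {P : Set} → Dec P → Formula A n → Formula A n
yes _ ⇒′ φ = φ
no _  ⇒′ φ = true

⇒′-quantifierFree : ∀ {P : Set} (P? : Dec P) {φ : Formula A n} → QuantifierFree φ → QuantifierFree (P? ⇒′ φ)
⇒′-quantifierFree (yes _) q = q
⇒′-quantifierFree (no _)  q = true

⊨-⇒′ : ∀ {P : Set} (P? : Dec P) {φ : Formula A n} {ρ : Vec (Position w) n} →
  (w , ρ ⊨ (P? ⇒′ φ)) ⇔ (P → w , ρ ⊨ φ)
⊨-⇒′ (yes p) = mk⇔ (λ sat _ → sat) (λ sat → sat p)
⊨-⇒′ (no ¬p) = mk⇔ (λ _ p → contradiction p ¬p) _

ordered : Fin n → Fin n → Formula A n
ordered i j = (i Fin.<? j) ⇒′ (i <′ j)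

-- The positive atomic diagram of model theory. Its satisfying assignments in `u` are the embeddings
-- of `w`, so its existential closure defines `↑ w`.
diagram : (w : List A) → Formula A (length w)
diagram w = ⋀ (λ i → P[ lookup w i ] i) ∧′ ⋀ (λ i → ⋀ (λ j → ordered i j))

diagram-quantifierFree : (w : List A) → QuantifierFree (diagram w)
diagram-quantifierFree w =
  ⋀-quantifierFree (λ i → P[ lookup w i ] i)
  ∧′ ⋀-quantifierFree (λ i → ⋀-quantifierFree (λ j → ⇒′-quantifierFree (i Fin.<? j) (i <′ j)))

⊨-diagram⇒Embedding : ∀ {ρ} → u , ρ ⊨ diagram w → Embedding w u
⊨-diagram⇒Embedding {ρ = ρ} _ .pos = Vec.lookup ρ
⊨-diagram⇒Embedding (_ , p) .pos-mono {i} {j} =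
  to (⊨-⇒′ (i Fin.<? j)) (to (⊨-⋀ (ordered i)) (to (⊨-⋀ (λ i → ⋀ (ordered i))) p i) j)
⊨-diagram⇒Embedding {w = w} (p , _) .pos-label = to (⊨-⋀ (λ i → P[ lookup w i ] i)) p

Embedding⇒⊨-diagram : (e : Embedding w u) → u , Vec.tabulate (e .pos) ⊨ diagram w
Embedding⇒⊨-diagram {w = w} {u = u} e =
    from (⊨-⋀ (λ i → P[ lookup w i ] i))
      (λ i → trans (cong (lookup u) (Vec.lookup∘tabulate (e .pos) i)) (e .pos-label i))
  , from (⊨-⋀ (λ i → ⋀ (ordered i))) (λ i → from (⊨-⋀ (ordered i)) (λ j → from (⊨-⇒′ (i Fin.<? j))
      (λ i<j → subst₂ Fin._<_ (sym (Vec.lookup∘tabulate (e .pos) i))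
                              (sym (Vec.lookup∘tabulate (e .pos) j)) (e .pos-mono i<j))))

↑-Σ₁ : (w : List A) → ↑ w ∈ Σ₁
↑-Σ₁ w =
    ∃* (diagram w)
  , (∃* (diagram w) , ∃*-prenex (matrix (diagram-quantifierFree w)) , id , id)
  , (λ s → from (⊨-∃* (diagram w)) (_ , Embedding⇒⊨-diagram (⊑⇒Embedding s)))
  , (λ {u} p → Embedding⇒⊑ w u (⊨-diagram⇒Embedding (proj₂ (to (⊨-∃* (diagram w)) p))))

-- Regular languages, after Myhill and Nerode

-- A right congruence of finite index that saturates `L`. Decidability is a separate field because
-- `saturated` does not tell which classes lie in `L`.
record Regular {A : Set} (L : Language A) : Set where
  field
    index     : ℕ
    class     : List A → Fin index
    class-++  : ∀ {u v} x → class u ≡ class v → class (u ++ x) ≡ class (v ++ x)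
    saturated : ∀ {u v} → class u ≡ class v → u ∈ L → v ∈ L
    dec       : Decidable L

open Regular

∁-regular : Regular L → Regular (∁ L)
∁-regular R = record
  { index = R .index
  ; class = R .class
  ; class-++ = R .class-++
  ; saturated = λ eq u∉L v∈L → u∉L (R .saturated (sym eq) v∈L)
  ; dec = λ w → ¬? (R .dec w)
  }

∩-regular : Regular L → Regular M → Regular (L ∩ M)
∩-regular R S = record
  { index = R .index * S .index
  ; class = λ w → combine (R .class w) (S .class w)
  ; class-++ = λ x eq → let (eqR , eqS) = Fin.combine-injective _ _ _ _ eq in
      cong₂ combine (R .class-++ x eqR) (S .class-++ x eqS)
  ; saturated = λ eq (p , q) → let (eqR , eqS) = Fin.combine-injective _ _ _ _ eq in
      R .saturated eqR p , S .saturated eqS q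
  ; dec = λ w → R .dec w ×-dec S .dec w
  }

⋂-regular : ∀ {I : Set} {K : I → Language A} → (∀ i → Regular (K i)) → ∀ is →
  Regular (λ w → All (λ i → w ∈ K i) is)
⋂-regular R [] = record
  { index = 1
  ; class = λ _ → zero
  ; class-++ = λ _ _ → refl
  ; saturated = λ _ _ → []
  ; dec = λ _ → yes []
  }
⋂-regular R (i ∷ is) = record
  { Regular R∩ using (index; class; class-++)
  ; saturated = λ { eq (p ∷ ps) → let (q , qs) = R∩ .saturated eq (p , ps) in q ∷ qs }
  ; dec = λ w → map′ (λ (p , ps) → p ∷ ps) (λ { (p ∷ ps) → p , ps }) (R∩ .dec w)
  }
  where R∩ = ∩-regular (R i) (⋂-regular R is)

quotient-regular : Regular L → ∀ u → Regular (λ v → u ++ v ∈ L)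
quotient-regular R u = record
  { index = R .index
  ; class = λ v → R .class (u ++ v)
  ; class-++ = λ {v} {v′} x eq →
      subst₂ (λ s t → R .class s ≡ R .class t) (++-assoc u v x) (++-assoc u v′ x) (R .class-++ x eq)
  ; saturated = R .saturated
  ; dec = λ v → R .dec (u ++ v)
  }

class-regular : (R : Regular L) → ∀ c → Regular (λ u → R .class u ≡ c)
class-regular R c = record
  { Regular R using (index; class; class-++)
  ; saturated = λ eq → trans (sym eq)
  ; dec = λ u → R .class u Fin.≟ c
  }

-- Pumping

take++drop-⊑ : ∀ {i j} (w : List A) → i ≤ j → take i w ++ drop j w ⊑ w
take++drop-⊑ {j = j} w z≤n =
  subst (drop j w ⊑_) (take++drop≡id j w) (++⁺ˡ (take j w) ⊆-refl)
take++drop-⊑ [] (s≤s i≤j) = []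
take++drop-⊑ (a ∷ w) (s≤s i≤j) = refl ∷ take++drop-⊑ w i≤j

length-drop-≤ : ∀ j (w : List A) → length (drop j w) ≤ length w
length-drop-≤ zero w = ℕ.≤-refl
length-drop-≤ (suc j) [] = z≤n
length-drop-≤ (suc j) (a ∷ w) = ℕ.m≤n⇒m≤1+n (length-drop-≤ j w)

take++drop-< : ∀ {i j} (w : List A) → i < j → j ≤ length w →
  length (take i w ++ drop j w) < length w
take++drop-< {i = zero}  {suc j} (a ∷ w) i<j j≤w = s≤s (length-drop-≤ j w)
take++drop-< {i = suc i} {suc j} (a ∷ w) (s≤s i<j) (s≤s j≤w) = s<s (take++drop-< w i<j j≤w)

-- Two prefixes of a long word share a class. Deleting the factor between them keeps the class of
-- the whole word, hence membership, and leaves a strictly shorter subword.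
short-subword : (R : Regular L) → w ∈ L → ∃[ v ] (v ⊑ w × length v ≤ R .index × v ∈ L)
short-subword {L = L} {w = w} R = go w (<-wellFounded _)
  where
  go : ∀ w → Acc _<_ (length w) → w ∈ L → ∃[ v ] (v ⊑ w × length v ≤ R .index × v ∈ L)
  go w (acc rs) w∈L with length w ℕ.≤? R .index
  ... | yes short = w , ⊆-refl , short , w∈L
  ... | no long =
    -- The `suc (length w)` prefix lengths run from 0 to `length w` inclusive.
    let i , j , i<j , eq = Fin.pigeonhole (ℕ.m<n⇒m<1+n (ℕ.≰⇒> long)) (λ i → R .class (take (toℕ i) w))
        cut = take (toℕ i) w ++ drop (toℕ j) w
        cut∈L = R .saturated
          (trans (cong (R .class) (sym (take++drop≡id (toℕ j) w)))
                 (R .class-++ (drop (toℕ j) w) (sym eq))) w∈L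
        v , v⊑cut , v-short , v∈L =
          go cut (rs (take++drop-< w i<j (Fin.toℕ≤pred[n] j))) cut∈L
    in v , ⊆-trans v⊑cut (take++drop-⊑ w (ℕ.<⇒≤ i<j)) , v-short , v∈L

-- Characteristic numbers of decidable subsets of Fin n

funToFin-cong : {f g : Fin m → Fin n} → f ≗ g → funToFin f ≡ funToFin g
funToFin-cong {zero}  f≗g = refl
funToFin-cong {suc m} f≗g = cong₂ combine (f≗g zero) (funToFin-cong (f≗g ∘ suc))

bit : {P : Set} → Dec P → Fin 2
bit P? = if does P? then suc zero else zero

bit-cong : ∀ {P Q : Set} (P? : Dec P) (Q? : Dec Q) → (P → Q) → (Q → P) → bit P? ≡ bit Q?
bit-cong (yes p) (yes q) P→Q Q→P = refl
bit-cong (yes p) (no ¬q) P→Q Q→P = contradiction (P→Q p) ¬q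
bit-cong (no ¬p) (yes q) P→Q Q→P = contradiction (Q→P q) ¬p
bit-cong (no ¬p) (no ¬q) P→Q Q→P = refl

bit-injective : ∀ {P Q : Set} (P? : Dec P) (Q? : Dec Q) → bit P? ≡ bit Q? → P → Q
bit-injective _       (yes q) _  _ = q
bit-injective (no ¬p) (no _)  _  p = contradiction p ¬p
bit-injective (yes _) (no _)  () _

-- Coding a subset by its bits lets sets of states serve as numbered classes in `Regular`, and turns
-- mutual inclusion into equality without function extensionality.
char : {P : Pred (Fin n) 0ℓ} → Decidable P → Fin (2 ^ n)
char P? = funToFin (λ i → bit (P? i))

module _ {P Q : Pred (Fin n) 0ℓ} (P? : Decidable P) (Q? : Decidable Q) where

  char-cong : P ⊆ Q → Q ⊆ P → char P? ≡ char Q?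
  char-cong P⊆Q Q⊆P = funToFin-cong {n} (λ i → bit-cong (P? i) (Q? i) P⊆Q Q⊆P)

  char-injective : char P? ≡ char Q? → P ⊆ Q
  char-injective eq {i} = bit-injective (P? i) (Q? i)
    (trans (sym (Fin.finToFun-funToFin (λ i → bit (P? i)) i))
           (trans (cong (λ c → finToFun c i) eq) (Fin.finToFun-funToFin (λ i → bit (Q? i)) i)))

-- Presentations are regular

module _ (𝒜 : NFA A) where
  open NFA 𝒜 hiding ([]; _∷_)
  private module N = NFA

  run-++ : ∀ {p q r u x} → Run p u q → Run q x r → Run p (u ++ x) r
  run-++ N.[]       ρ = ρ
  run-++ (δ∋ N.∷ π) ρ = δ∋ N.∷ run-++ π ρ

  run-split : ∀ {p r} u {x} → Run p (u ++ x) r → ∃[ q ] (Run p u q × Run q x r)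
  run-split []      ρ = _ , N.[] , ρ
  run-split (a ∷ u) (δ∋ N.∷ ρ) = let q , π , ρ′ = run-split u ρ in q , δ∋ N.∷ π , ρ′

  run? : ∀ p w r → Dec (Run p w r)
  run? p [] r = map′ (λ { refl → N.[] }) (λ { N.[] → refl }) (p Fin.≟ r)
  run? p (a ∷ w) r = map′ (λ { (q , δ∋ , π) → δ∋ N.∷ π }) (λ { (δ∋ N.∷ π) → _ , δ∋ , π })
    (Fin.any? (λ q → (q ∈? δ p a) ×-dec run? q w r))

  Reached : List A → Pred (Fin states) 0ℓ
  Reached w q = ∃[ p ] (p Subset.∈ initial × Run p w q)

  reached? : ∀ w → Decidable (Reached w)
  reached? w q = Fin.any? (λ p → (p ∈? initial) ×-dec run? p w q)

  -- A run over `u ++ x` passes through a state reached by `u`; its part up to there is replaced by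
  -- a run over `v`.
  reached-++ : ∀ {u v} x → Reached u ⊆ Reached v → Reached (u ++ x) ⊆ Reached (v ++ x)
  reached-++ {u} x u⊆v (p , p∈I , π) =
    let q , π₁ , π₂ = run-split u π
        p′ , p′∈I , π₁′ = u⊆v (p , p∈I , π₁)
    in p′ , p′∈I , run-++ π₁′ π₂

  -- The subset construction: the class of a word is the set of states that it reaches.
  NFA-regular : Regular Accepts
  NFA-regular = record
    { index = 2 ^ states
    ; class = λ w → char (reached? w)
    ; class-++ = λ {u} {v} x eq → char-cong (reached? (u ++ x)) (reached? (v ++ x))
        (reached-++ x (char-injective (reached? u) (reached? v) eq))
        (reached-++ x (char-injective (reached? v) (reached? u) (sym eq)))
    ; saturated = λ { {u} {v} eq (p , r , p∈I , π , r∈F) →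
        let p′ , p′∈I , π′ = char-injective (reached? u) (reached? v) eq (p , p∈I , π)
        in p′ , r , p′∈I , π′ , r∈F }
    ; dec = λ w → Fin.any? λ p → Fin.any? λ r → (p ∈? initial) ×-dec run? p w r ×-dec (r ∈? final)
    }

monoid-regular : (ℳ : MonoidRecognizer A) → Regular (MonoidRecognizer.Recognizes ℳ)
monoid-regular ℳ = record
  { index = size
  ; class = α
  ; class-++ = λ {u} {v} x eq → trans (homo u x) (trans (cong (_∙ α x) eq) (sym (homo v x)))
  ; saturated = subst (Subset._∈ F)
  ; dec = λ w → α w ∈? F
  }
  where
  open MonoidRecognizer ℳ
  open IsMonoidHomomorphism isHomomorphism using (homo)

⟦⟧-regular : (P : RegularPresentation A) → Regular ⟦ P ⟧
⟦⟧-regular (nfa 𝒜)      = NFA-regular 𝒜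
⟦⟧-regular (morphism ℳ) = monoid-regular ℳ

-- Emptiness tests and the regularity of downward closures

⊑-split : ∀ (w : List A) {x u} → w ++ x ⊑ u → ∃[ u₁ ] ∃[ u₂ ] (u ≡ u₁ ++ u₂ × w ⊑ u₁ × x ⊑ u₂)
⊑-split [] {u = u} s = [] , u , refl , [] , s
⊑-split (a ∷ w) (y ∷ʳ s) =
  let u₁ , u₂ , eq , s₁ , s₂ = ⊑-split (a ∷ w) s in y ∷ u₁ , u₂ , cong (y ∷_) eq , y ∷ʳ s₁ , s₂
⊑-split (a ∷ w) (eq₀ ∷ s) =
  let u₁ , u₂ , eq , s₁ , s₂ = ⊑-split w s in _ ∷ u₁ , u₂ , cong (_ ∷_) eq , eq₀ ∷ s₁ , s₂

∷-⊑-split : ∀ {a : A} → a ∷ w ⊑ u → ∃[ v ] ∃[ u′ ] (u ≡ v ++ a ∷ u′ × w ⊑ u′)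
∷-⊑-split (y ∷ʳ s) = let v , u′ , eq , s′ = ∷-⊑-split s in y ∷ v , u′ , cong (y ∷_) eq , s′
∷-⊑-split (refl ∷ s) = [] , _ , refl , s

module _ {A : Set} {k} (A↔Fin : A ↔ Fin k) where

  letters : List A
  letters = map (Inverse.from A↔Fin) (allFin k)

  ∈-letters : ∀ a → a ∈ˡ letters
  ∈-letters a = subst (_∈ˡ letters) (Inverse.strictlyInverseʳ A↔Fin a)
    (∈-map⁺ (Inverse.from A↔Fin) (∈-allFin (Inverse.to A↔Fin a)))

  wordsUpTo : ℕ → List (List A)
  wordsUpTo zero    = [ [] ]
  wordsUpTo (suc n) = [] ∷ cartesianProductWith _∷_ letters (wordsUpTo n)

  ∈-wordsUpTo : ∀ {n} w → length w ≤ n → w ∈ˡ wordsUpTo n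
  ∈-wordsUpTo {zero}  []      _ = Any.here refl
  ∈-wordsUpTo {suc n} []      _ = Any.here refl
  ∈-wordsUpTo {suc n} (a ∷ w) (s≤s w≤n) =
    Any.there (∈-cartesianProductWith⁺ _∷_ (∈-letters a) (∈-wordsUpTo w w≤n))

  -- By `short-subword`, a nonempty language has a word no longer than the index, and the finite
  -- alphabet leaves finitely many candidates.
  nonempty? : {L : Language A} → Regular L → Dec (∃[ w ] w ∈ L)
  nonempty? R = map′ Any.satisfied
    (λ (w , w∈L) → let v , _ , v-short , v∈L = short-subword R w∈L in lose (∈-wordsUpTo v v-short) v∈L)
    (any? (R .dec) (wordsUpTo (R .index)))

  -- a ∷ w is a subword of a word of L exactly when some v satisfies w ∈ ↓ ((v a)⁻¹ L),
  -- a condition on v that inherits the right congruence of L.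
  ↓-dec : {L : Language A} → Regular L → Decidable (↓ L)
  ↓-dec R [] = map′ (map₂ (minimum _ ,_)) (map₂ proj₂) (nonempty? R)
  ↓-dec {L} R (a ∷ w) = map′
    (λ (v , u , w⊑u , vau∈L) → v ++ a ∷ u , ++⁺ˡ v (refl ∷ w⊑u) , subst L (++-assoc v [ a ] u) vau∈L)
    (λ { (u , aw⊑u , u∈L) → let v , u′ , eq , w⊑u′ = ∷-⊑-split aw⊑u in
        v , u′ , w⊑u′ , subst L (trans eq (sym (++-assoc v [ a ] u′))) u∈L })
    (nonempty? {λ v → ↓ (λ u → (v ++ [ a ]) ++ u ∈ L) w} record
      { Regular R using (index; class; class-++)
      ; saturated = λ eq (u , w⊑u , p) →
          u , w⊑u , R .saturated (R .class-++ u (R .class-++ [ a ] eq)) p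
      ; dec = λ v → ↓-dec (quotient-regular R (v ++ [ a ])) w
      })

  module _ {L : Language A} (R : Regular L) where

    -- The counterpart of `Reached` for the automaton whose states are the classes of `R` and which
    -- may insert letters anywhere in its input.
    Above : List A → Pred (Fin (R .index)) 0ℓ
    Above w c = w ∈ ↓ (λ u → R .class u ≡ c)

    above? : ∀ w → Decidable (Above w)
    above? w c = ↓-dec (class-regular R c) w

    -- A superword of `w ++ x` splits as `u₁ ++ u₂`. A superword of `v` in the class of `u₁`
    -- replaces `u₁`, and the right congruence absorbs `u₂`.
    above-++ : ∀ {w v} x → Above w ⊆ Above v → Above (w ++ x) ⊆ Above (v ++ x)
    above-++ {w} x w⊆v (u , wx⊑u , refl) with ⊑-split w wx⊑u
    ... | u₁ , u₂ , refl , w⊑u₁ , x⊑u₂ =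
      let u₁′ , v⊑u₁′ , eq = w⊆v (u₁ , w⊑u₁ , refl)
      in u₁′ ++ u₂ , ++⁺ v⊑u₁′ x⊑u₂ , R .class-++ u₂ eq

    ↓-regular : Regular (↓ L)
    ↓-regular = record
      { index = 2 ^ R .index
      ; class = λ w → char (above? w)
      ; class-++ = λ {w} {v} x eq → char-cong (above? (w ++ x)) (above? (v ++ x))
          (above-++ x (char-injective (above? w) (above? v) eq))
          (above-++ x (char-injective (above? v) (above? w) (sym eq)))
      -- Instantiated at the class of `u` itself, equality of codes yields a superword of `v`
      -- congruent to `u`, hence in `L`.
      ; saturated = λ {w} {v} eq (u , w⊑u , u∈L) →
          let u′ , v⊑u′ , eq′ = char-injective (above? w) (above? v) eq (u , w⊑u , refl)
          in u′ , v⊑u′ , R .saturated (sym eq′) u∈L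
      ; dec = ↓-dec R
      }

  -- Coverability as disjointness

  module _ (𝐋 : List (RegularPresentation A)) where

    -- For empty `𝐋` this contains every word, in accordance with the empty cover being the only
    -- separating one.
    ⋂↓ : Language A
    ⋂↓ w = All (λ P → w ∈ ↓ ⟦ P ⟧) 𝐋

    ⋂↓-regular : Regular ⋂↓
    ⋂↓-regular = ⋂-regular (λ P → ↓-regular (⟦⟧-regular P)) 𝐋

    coverable⇒disjoint : {L : Language A} → Coverable Σ₁ L (map ⟦_⟧ 𝐋) → ¬ (∃[ w ] w ∈ L ∩ ⋂↓)
    coverable⇒disjoint (𝐊 , (𝐊⊆Σ₁ , L⊆⋃𝐊) , separating) (w , w∈L , w∈⋂↓) =
      All.lookupAny (All.zip (𝐊⊆Σ₁ , separating)) (L⊆⋃𝐊 w∈L) |> λ ((K∈Σ₁ , sep) , w∈K) →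
      All.lookupAny w∈⋂↓ (Any.map⁻ sep) |> λ ((u , w⊑u , u∈L′) , K∩L′=∅) →
      K∩L′=∅ u (Σ₁-upward-closed K∈Σ₁ w⊑u w∈K , u∈L′)

    disjoint⇒coverable : {L : Language A} → ¬ (∃[ w ] w ∈ L ∩ ⋂↓) → Coverable Σ₁ L (map ⟦_⟧ 𝐋)
    disjoint⇒coverable {L} disjoint =
        map ↑ basis
      , (All.map⁺ (All.universal ↑-Σ₁ basis) , covers)
      , All.map⁺ (All.map separates (All.all-filter (outside .dec) (wordsUpTo (outside .index))))
      where
      outside : Regular (∁ ⋂↓)
      outside = ∁-regular ⋂↓-regular

      basis : List (List A)
      basis = filter (outside .dec) (wordsUpTo (outside .index))

      covers : L ⊆ ⋃ (map ↑ basis)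
      covers {w} w∈L =
        let v , v⊑w , v-short , v∉⋂↓ = short-subword outside (λ w∈⋂↓ → disjoint (w , w∈L , w∈⋂↓))
        in Any.map⁺ (lose (∈-filter⁺ (outside .dec) (∈-wordsUpTo v v-short) v∉⋂↓) v⊑w)

      separates : ∀ {v} → ¬ ⋂↓ v → Any (λ L′ → ∀ u → ¬ (v ⊑ u × u ∈ L′)) (map ⟦_⟧ 𝐋)
      -- Decidability of each `↓ ⟦ P ⟧` turns the failed conjunction into an actual member of `𝐋`.
      -- That `v` is outside its downward closure says that `↑ v` misses it.
      separates {v} v∉⋂↓ = Any.map⁺ (Any.map (λ v∉↓ u p → v∉↓ (u , p))
        (All.¬All⇒Any¬ (λ P → ↓-dec (⟦⟧-regular P) v) 𝐋 v∉⋂↓))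

corollary10p5 : ∀ {k} {A : Set} → A ↔ Fin k →
    (L : RegularPresentation A) (𝐋 : List (RegularPresentation A)) →
    Dec (Coverable Σ₁ ⟦ L ⟧ (map ⟦_⟧ 𝐋))
corollary10p5 A↔Fin L 𝐋 = map′
  (disjoint⇒coverable A↔Fin 𝐋)
  (λ coverable meets → coverable⇒disjoint A↔Fin 𝐋 coverable meets)
  (¬? (nonempty? A↔Fin (∩-regular (⟦⟧-regular L) (⋂↓-regular A↔Fin 𝐋))))
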